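{- Let $n\ge1$. The map assigning to each $\pi\in\mathcal{S}_n$ its filled shape (the diagram $\Lambda(\pi)$ together with the set of its dotted cells) is injective: if $\pi,\sigma\in\mathcal{S}_n$ have the same shape $\Lambda(\pi)=\Lambda(\sigma)$ and the same set of dotted cells, then $\pi=\sigma$.
   Context: $\mathcal{S}_n$ is the set of permutations $\pi=\pi_1\cdots\pi_n$ of $[n]=\{1,\ldots,n\}$, written as words. The standardization $w^{\ast}$ of a word $w$ of $m$ distinct positive integers is the permutation in $\mathcal{S}_m$ obtained by replacing the $i$th smallest letter by $i$. The map $D$ from permutations in $\mathcal{S}_n$ to Dyck words of length $2n$ in the letters $\mathsf{u}$ (up step $(0,1)$) and $\mathsf{r}$ (right step $(1,0)$) is defined recursively by $D(\emptyset)=\emptyset$ and, for $\pi=\pi_L\,n\,\pi_R\in\mathcal{S}_n$ with $n\ge1$ ($\pi_L,\pi_R$ the possibly empty words to the left and right of the letter $n$), $D(\pi)=\mathsf{u}\,D(\pi_L^{\ast})\,\mathsf{r}\,D(\pi_R^{\ast})$. $\Lambda(\pi)$ is the partition with exactly $n-1$ parts (parts equal to $0$ allowed) whose Young diagram (left-justified, longest row on top) is the region above the path $D(\pi)$ drawn from $(0,0)$ to $(n,n)$. Equivalently, the parts of $\Lambda(\pi)$ are, in weakly decreasing order, the numbers of letters $\mathsf{r}$ preceding the 2nd, 3rd, ..., $n$th letter $\mathsf{u}$ in $D(\pi)$. The left border number $a_j$ of $\pi$ is the largest position $m<j$ with $\pi_m>\pi_j$, or $0$ if no such position exists; the parts of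 $\Lambda(\pi)$ are the numbers $a_2,\ldots,a_n$ sorted in weakly decreasing order. Filled shape of $\pi$: label the columns of $\Lambda(\pi)$ from left to right by $1,2,\ldots,k$, where $k$ is the last descent of $\pi$ (the largest $i$ with $\pi_i>\pi_{i+1}$). For each $i\ge1$, label the rows of length $i$ from bottom to top with the numbers $j$, in increasing order, for which $a_j=i$. Put a dot into the cell in the column labeled $i$ and the row labeled $j$ whenever $(i,j)$ is an inversion of $\pi$, i.e. $i<j$ and $\pi_i>\pi_j$. -}

module Defs where

open import Data.Fin as Fin using (Fin; toℕ)
open import Data.Fin.Permutation using (Permutation′; _⟨$⟩ʳ_)
open import Data.List.Base
  using (List; []; _∷_; [_]; _++_; allFin; drop; dropWhile; filter; foldr; length; lookup; map; reverse; tabulate; takeWhile; zip)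
open import Data.List.Membership.Propositional using (_∈_)
open import Data.Nat using (ℕ; zero; suc; _≤_; _≤?_; _≟_; _⊔_)
open import Data.Product using (_×_; _,_; ∃-syntax; Σ-syntax)
open import Level using (0ℓ)
open import Relation.Binary.PropositionalEquality using (_≡_)
open import Relation.Nullary.Decidable using (Dec; ¬?; _×-dec_)
open import Relation.Unary using (Pred; _≐_)

-- The permutation π of {1,…,n} is a Permutation′ n; the element i : Fin n
-- stands for the position, or letter, val i = toℕ i + 1.

val : ∀ {n} → Fin n → ℕ
val i = suc (toℕ i)

word : ∀ {n} → Permutation′ n → List ℕ
word π = tabulate (λ i → val (π ⟨$⟩ʳ i))

standardize : List ℕ → List ℕ
standardize w = map (λ x → length (filter (_≤? x) w)) w

data Step : Set where
  u r : Step

before after : ℕ → List ℕ → List ℕ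
before x w = takeWhile (λ y → ¬? (y ≟ x)) w
after  x w = drop 1 (dropWhile (λ y → ¬? (y ≟ x)) w)

-- The first argument only bounds the recursion depth. On a permutation word the
-- recursive calls are on strictly shorter words, so length w is always enough.
dyckWithin : ℕ → List ℕ → List Step
dyckWithin zero    w         = []
dyckWithin (suc d) []        = []
dyckWithin (suc d) w@(_ ∷ _) =
  [ u ] ++ dyckWithin d (standardize (before (length w) w)) ++
  [ r ] ++ dyckWithin d (standardize (after  (length w) w))

dyckWord : List ℕ → List Step
dyckWord w = dyckWithin (length w) w

-- The x-coordinates of the up steps of a path starting at x-coordinate x, i.e.
-- the lengths, from bottom to top, of the rows of the region above the path.
upAbscissae : ℕ → List Step → List ℕ
upAbscissae x []      = []
upAbscissae x (u ∷ s) = x ∷ upAbscissae x s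
upAbscissae x (r ∷ s) = upAbscissae (suc x) s

-- Parts in weakly decreasing order. The first up step, always at abscissa 0, is
-- dropped: this leaves exactly n − 1 parts, some possibly 0.
Λ : ∀ {n} → Permutation′ n → List ℕ
Λ π = reverse (drop 1 (upAbscissae 0 (dyckWord (word π))))

Inversion : ∀ {n} → Permutation′ n → Fin n → Fin n → Set
Inversion π i j = i Fin.< j × (π ⟨$⟩ʳ i) Fin.> (π ⟨$⟩ʳ j)

inversion? : ∀ {n} (π : Permutation′ n) (i j : Fin n) → Dec (Inversion π i j)
inversion? π i j = (i Fin.<? j) ×-dec ((π ⟨$⟩ʳ j) Fin.<? (π ⟨$⟩ʳ i))

-- Positions m < j with π_m > π_j are exactly those making (m , j) an inversion;
-- the maximum of the empty list is 0.
leftBorder : ∀ {n} → Permutation′ n → Fin n → ℕ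
leftBorder {n} π j = foldr _⊔_ 0 (map val (filter (λ m → inversion? π m j) (allFin n)))

-- Rows are indexed from top to bottom, hence the reversal.
rowsOfLengthFromBottom : (μ : List ℕ) → ℕ → List (Fin (length μ))
rowsOfLengthFromBottom μ i = reverse (filter (λ s → lookup μ s ≟ i) (allFin (length μ)))

positionsWithBorder : ∀ {n} → Permutation′ n → ℕ → List (Fin n)
positionsWithBorder {n} π i = filter (λ j → leftBorder π j ≟ i) (allFin n)

RowLabel : ∀ {n} (π : Permutation′ n) → Fin (length (Λ π)) → Fin n → Set
RowLabel π s j =
  ∃[ i ] 1 ≤ i × (s , j) ∈ zip (rowsOfLengthFromBottom (Λ π) i) (positionsWithBorder π i)

-- (row , column), both counted from 1, rows from the top and columns from the left.
Cell : Set
Cell = ℕ × ℕ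

-- The label of a column is its number counted from the left, so column labels
-- need no separate definition; val i ≤ lookup (Λ π) s says that the cell in
-- row s and column i belongs to the diagram.
Dotted : ∀ {n} → Permutation′ n → Pred Cell 0ℓ
Dotted {n} π c =
  Σ[ s ∈ Fin (length (Λ π)) ] Σ[ i ∈ Fin n ] Σ[ j ∈ Fin n ]
    c ≡ (val s , val i) × val i ≤ lookup (Λ π) s × RowLabel π s j × Inversion π i j

record FilledShape : Set₁ where
  constructor _▸_
  field
    shape : List ℕ
    dots  : Pred Cell 0ℓ

open FilledShape public

_≋_ : FilledShape → FilledShape → Set
F ≋ G = shape F ≡ shape G × dots F ≐ dots G

filledShape : ∀ {n} → Permutation′ n → FilledShape
filledShape π = Λ π ▸ Dotted π

{-# OPTIONS --safe #-}

-- Splitting a word at its maximal letter n is what D does recursively, and the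
-- letters to the right of n see nothing to the left of n; hence the parts of Λ(π)
-- are the left borders of π, the first one being omitted. The multiset of borders
-- determines the border of each position: at the first position j where two
-- permutations π and σ differ, say with border m for π and a smaller one for σ,
-- σ_j > σ_m, so in σ no position after j has border m, and σ has fewer positions
-- with border m than π. So the shape determines the row labels, with which the dots
-- are the inversions, and a permutation is determined by its inversions.

module Submission where

open import Defs
open import Data.Nat using (ℕ; _≥_)
open import Data.Fin.Permutation using (Permutation′; _≈_)
open import Function.Definitions using (Injective)

open import Data.Bool.Base using (Bool; true; false; if_then_else_; _∧_)
open import Data.Fin as Fin using (Fin; toℕ)
import Data.Fin.Induction as Finᵢ
open import Data.Fin.Permutation using (_⟨$⟩ʳ_; _⟨$⟩ˡ_; inverseˡ; inverseʳ)
import Data.Fin.Properties as Finₚ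
open import Data.List.Base
  using (List; []; _∷_; _++_; allFin; drop; filter; foldr; length; lookup; map; tabulate; zip)
open import Data.List.Extrema.Nat using (max; xs≤max; argmax-sel)
open import Data.List.Membership.Propositional using (_∈_)
open import Data.List.Membership.Propositional.Properties
  using (foldr-selective; ∈-allFin; ∈-filter⁺; ∈-filter⁻; ∈-map⁺; ∈-map⁻; ∈-tabulate⁺)
open import Data.List.Properties
  using (filter-all; filter-≐; length-++; length-filter; length-map; length-reverse;
         length-tabulate; map-id; map-tabulate; tabulate-cong; tabulate-lookup)
open import Data.List.Relation.Binary.Permutation.Propositional
  using (_↭_; ↭-refl; ↭-sym; ↭-trans; ↭-reflexive; ↭⇒↭ₛ; prep; module PermutationReasoning)
open import Data.List.Relation.Binary.Permutation.Propositional.Properties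
  using (filter-↭; ∈-resp-↭; ↭-length; ↭-reverse; shift; ++⁺)
open import Data.List.Relation.Binary.Permutation.Setoid.Properties using (Unique-resp-↭)
open import Data.List.Relation.Unary.All as All using (All; []; _∷_)
import Data.List.Relation.Unary.All.Properties as Allₚ
open import Data.List.Relation.Unary.AllPairs as AllPairs using ([]; _∷_)
open import Data.List.Relation.Unary.Any using (here; there)
open import Data.List.Relation.Unary.Unique.Propositional using (Unique)
import Data.List.Relation.Unary.Unique.Propositional.Properties as Uniqueₚ
open import Data.Nat
  using (zero; suc; _+_; _≤_; _<_; _≤?_; _<?_; _≟_; _⊔_; z≤n; s≤s; s≤s⁻¹)
open import Data.Nat.Properties hiding (_≟_; _≤?_; _<?_)
open import Data.Product using (_×_; _,_; proj₁; proj₂; ∃-syntax; Σ-syntax)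
open import Data.Sum using (inj₁; inj₂)
open import Function using (_∘_; id; const; mk⇔)
import Induction.WellFounded as WF
open import Level using (0ℓ)
open import Relation.Binary using (tri<; tri≈; tri>)
open import Relation.Binary.PropositionalEquality
open import Relation.Nullary using (¬_; yes; no; does; contradiction)
open import Relation.Nullary.Decidable using (does-⇔; dec-true; dec-false)
open import Relation.Unary using (Decidable)

private variable
  A B : Set
  k n : ℕ

-- Lengths of filtered lists

module _ {P Q : A → Set} (P? : Decidable P) (Q? : Decidable Q) (P⊆Q : ∀ {x} → P x → Q x) where

  length-filter-mono : ∀ xs → length (filter P? xs) ≤ length (filter Q? xs)
  length-filter-mono [] = z≤n
  length-filter-mono (x ∷ xs) with P? x | Q? x
  ... | yes _ | yes _  = s≤s (length-filter-mono xs)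
  ... | yes p | no ¬q  = contradiction (P⊆Q p) ¬q
  ... | no _  | yes _  = m≤n⇒m≤1+n (length-filter-mono xs)
  ... | no _  | no _   = length-filter-mono xs

  length-filter-strictMono : ∀ {x xs} → x ∈ xs → Q x → ¬ P x →
                             length (filter P? xs) < length (filter Q? xs)
  length-filter-strictMono {xs = y ∷ xs} (here refl) q ¬p with P? y | Q? y
  ... | yes p | _     = contradiction p ¬p
  ... | no _  | yes _ = s≤s (length-filter-mono xs)
  ... | no _  | no ¬q = contradiction q ¬q
  length-filter-strictMono {xs = y ∷ xs} (there x∈) q ¬p with P? y | Q? y
  ... | yes _ | yes _ = s≤s (length-filter-strictMono x∈ q ¬p)
  ... | yes p | no ¬q = contradiction (P⊆Q p) ¬q
  ... | no _  | yes _ = m≤n⇒m≤1+n (length-filter-strictMono x∈ q ¬p)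
  ... | no _  | no _  = length-filter-strictMono x∈ q ¬p

length-filter-map : {P : B → Set} (P? : Decidable P) (f : A → B) → ∀ xs →
                    length (filter P? (map f xs)) ≡ length (filter (P? ∘ f) xs)
length-filter-map P? f [] = refl
length-filter-map P? f (x ∷ xs) with does (P? (f x))
... | true  = cong suc (length-filter-map P? f xs)
... | false = length-filter-map P? f xs

-- Left borders of words

-- The border function b maps a letter to the left border that it would have if
-- it came next; push c y updates it after the letter y in position suc c.
push : ℕ → ℕ → (ℕ → ℕ) → ℕ → ℕ
push c y b z = if does (z <? y) then suc c else b z

borders : ℕ → (ℕ → ℕ) → List ℕ → List ℕ
borders c b []      = []
borders c b (y ∷ w) = b y ∷ borders (suc c) (push c y b) w

pushAll : ℕ → (ℕ → ℕ) → List ℕ → ℕ → ℕ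
pushAll c b []      = b
pushAll c b (y ∷ w) = pushAll (suc c) (push c y b) w

borders-++ : ∀ c b v w →
  borders c b (v ++ w) ≡ borders c b v ++ borders (c + length v) (pushAll c b v) w
borders-++ c b []      w rewrite +-identityʳ c = refl
borders-++ c b (y ∷ v) w rewrite +-suc c (length v) =
  cong (b y ∷_) (borders-++ (suc c) (push c y b) v w)

push-< : ∀ {c y b z} → z < y → push c y b z ≡ suc c
push-< {c} {y} {b} {z} z<y rewrite dec-true (z <? y) z<y = refl

push-≥ : ∀ {c y b z} → y ≤ z → push c y b z ≡ b z
push-≥ {c} {y} {b} {z} y≤z rewrite dec-false (z <? y) (≤⇒≯ y≤z) = refl

pushAll-≥ : ∀ c b {z w} → All (_≤ z) w → pushAll c b w z ≡ b z
pushAll-≥ c b []           = refl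
pushAll-≥ c b {w = y ∷ _} (y≤z ∷ w≤z) =
  trans (pushAll-≥ (suc c) (push c y b) w≤z) (push-≥ {c} {b = b} y≤z)

-- `borders` looks at letters only through `<?` and the initial border function, so a relabelling
-- that keeps the comparisons within the word changes nothing. With `id` for `f` the lemma serves to
-- exchange the initial border function on the letters of `w`.
borders-map : ∀ {c} (f : ℕ → ℕ) w {b b′} →
  (∀ {y z} → y ∈ w → z ∈ w → does (f z <? f y) ≡ does (z <? y)) →
  (∀ {y} → y ∈ w → b (f y) ≡ b′ y) →
  borders c b (map f w) ≡ borders c b′ w
borders-map f []      emb eq = refl
borders-map {c} f (y ∷ w) emb eq = cong₂ _∷_ (eq (here refl))
  (borders-map f w (λ y∈ z∈ → emb (there y∈) (there z∈)) λ z∈ →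
    cong₂ (if_then suc c else_) (emb (here refl) (there z∈)) (eq (there z∈)))

borders-cong : ∀ {c} w {b b′} → (∀ {y} → y ∈ w → b y ≡ b′ y) → borders c b w ≡ borders c b′ w
borders-cong {c} w {b} eq =
  trans (cong (borders c b) (sym (map-id w))) (borders-map id w (λ _ _ → refl) eq)

-- No letter of `L` exceeds `m`, so `m` keeps the initial border `x`. Reading `m` then resets the
-- border of every smaller letter to the position of `m`, which hides `L` from `R`.
borders-split : ∀ x L {m R} → All (_≤ m) L → All (_< m) R →
  borders x (const x) (L ++ m ∷ R) ≡
    borders x (const x) L ++ x ∷ borders (suc (x + length L)) (const (suc (x + length L))) R
borders-split x L {m} {R} L≤m R<m = trans (borders-++ x (const x) L (m ∷ R))
  (cong₂ (λ y bs → borders x (const x) L ++ y ∷ bs)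
    (pushAll-≥ x (const x) L≤m)
    (borders-cong R λ z∈ → push-< {b = pushAll x (const x) L} (All.lookup R<m z∈)))

-- Standardization

rank : List ℕ → ℕ → ℕ
rank w x = length (filter (_≤? x) w)

rank-mono-≤ : ∀ w {x y} → x ≤ y → rank w x ≤ rank w y
rank-mono-≤ w x≤y = length-filter-mono (_≤? _) (_≤? _) (λ z≤x → ≤-trans z≤x x≤y) w

rank-mono-< : ∀ {w x y} → y ∈ w → x < y → rank w x < rank w y
rank-mono-< y∈ x<y = length-filter-strictMono (_≤? _) (_≤? _)
  (λ z≤x → ≤-trans z≤x (<⇒≤ x<y)) y∈ ≤-refl (<⇒≱ x<y)

rank-cancel-< : ∀ w {x y} → rank w x < rank w y → x < y
rank-cancel-< w r< = ≰⇒> λ y≤x → <⇒≱ r< (rank-mono-≤ w y≤x)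

rank-injective : ∀ {w x y} → x ∈ w → y ∈ w → rank w x ≡ rank w y → x ≡ y
rank-injective {w} {x} {y} x∈ y∈ eq with <-cmp x y
... | tri< x<y _ _ = contradiction eq (<⇒≢ (rank-mono-< y∈ x<y))
... | tri≈ _ x≡y _ = x≡y
... | tri> _ _ y<x = contradiction (sym eq) (<⇒≢ (rank-mono-< x∈ y<x))

borders-standardize : ∀ x w → borders x (const x) (standardize w) ≡ borders x (const x) w
borders-standardize x w = borders-map (rank w) w
  (λ y∈ _ → does-⇔ (mk⇔ (rank-cancel-< w) (rank-mono-< y∈)) (_ <? _) (_ <? _))
  (λ _ → refl)

-- Injectivity is asked for on the letters of `w` only, since `rank w` need not be injective beyond
-- them.
Unique-map : {f : A → B} → ∀ {w} → (∀ {x y} → x ∈ w → y ∈ w → f x ≡ f y → x ≡ y) →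
             Unique w → Unique (map f w)
Unique-map inj [] = []
Unique-map inj (x∉ ∷ w!) =
  Allₚ.map⁺ (All.tabulate λ y∈ fx≡fy → All.lookup x∉ y∈ (inj (here refl) (there y∈) fx≡fy))
  ∷ Unique-map (λ x∈ y∈ → inj (there x∈) (there y∈)) w!

-- The invariant of the recursion in `dyckWithin`: it ensures that the search for the letter
-- `length w` cuts the word at its maximum. `top` has a premise because the empty word has no
-- letters.
record Standard (w : List ℕ) : Set where
  field
    unique  : Unique w
    bounded : All (_≤ length w) w
    top     : 0 < length w → length w ∈ w

max∈ : ∀ x w → max x (x ∷ w) ∈ x ∷ w
max∈ x w with argmax-sel id x (x ∷ w)
... | inj₁ eq = here eq
... | inj₂ m∈ = m∈

standardize-Standard : ∀ {w} → Unique w → Standard (standardize w)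
standardize-Standard {[]} w! = record { unique = []; bounded = []; top = λ () }
standardize-Standard {w@(x ∷ v)} w! = record
  { unique  = Unique-map rank-injective w!
  ; bounded = Allₚ.map⁺ (All.tabulate λ {y} _ →
      ≤-trans (length-filter (_≤? y) w) (≤-reflexive (sym (length-map (rank w) w))))
  -- All letters are at most the maximum, so its rank is the full length.
  ; top     = λ _ → subst (_∈ standardize w)
      (trans (cong length (filter-all (_≤? max x w) (xs≤max x w))) (sym (length-map (rank w) w)))
      (∈-map⁺ (rank w) (max∈ x v))
  }

-- The Dyck path

before-after : ∀ {m w} → m ∈ w → before m w ++ m ∷ after m w ≡ w
before-after {m} {y ∷ w} m∈ with y ≟ m
before-after {m} {y ∷ w} m∈          | yes refl rewrite dec-true (m ≟ m) refl = refl
before-after {m} {y ∷ w} (here m≡y)  | no y≢m = contradiction (sym m≡y) y≢m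
before-after {m} {y ∷ w} (there m∈)  | no y≢m rewrite dec-false (y ≟ m) y≢m =
  cong (y ∷_) (before-after m∈)

Unique-++⁻ˡ : (v : List A) {w : List A} → Unique (v ++ w) → Unique v
Unique-++⁻ˡ []      _          = []
Unique-++⁻ˡ (x ∷ v) (x∉ ∷ vw!) = Allₚ.++⁻ˡ v x∉ ∷ Unique-++⁻ˡ v vw!

Unique-++⁻ʳ : (v : List A) {w : List A} → Unique (v ++ w) → Unique w
Unique-++⁻ʳ []      vw!       = vw!
Unique-++⁻ʳ (x ∷ v) (_ ∷ vw!) = Unique-++⁻ʳ v vw!

-- The two inequalities match the two cases of `push`: letters of `L` leave the border of `m` alone,
-- and `m` resets that of each letter of `R`.
record IsSplit (w L : List ℕ) (m : ℕ) (R : List ℕ) : Set where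
  field
    word≡    : L ++ m ∷ R ≡ w
    L≤m      : All (_≤ m) L
    R<m      : All (_< m) R
    L-unique : Unique L
    R-unique : Unique R

  length≡ : length L + suc (length R) ≡ length w
  length≡ = trans (sym (length-++ L)) (cong length word≡)

split : ∀ {w} → Standard w → 0 < length w →
        IsSplit w (before (length w) w) (length w) (after (length w) w)
split {w} std 0<|w| = record
  { word≡    = w≡
  ; L≤m      = Allₚ.++⁻ˡ L LmR≤m
  ; R<m      = All.zipWith (λ (y≤m , m≢y) → ≤∧≢⇒< y≤m (m≢y ∘ sym))
                 (All.tail (Allₚ.++⁻ʳ L LmR≤m) , AllPairs.head mR-unique)
  ; L-unique = Unique-++⁻ˡ L LmR-unique
  ; R-unique = AllPairs.tail mR-unique
  }
  where
  open Standard std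
  L          = before (length w) w
  w≡         = before-after (top 0<|w|)
  LmR≤m      = subst (All (_≤ length w)) (sym w≡) bounded
  LmR-unique = subst Unique (sym w≡) unique
  mR-unique  = Unique-++⁻ʳ L LmR-unique

rights : List Step → ℕ
rights []      = 0
rights (u ∷ s) = rights s
rights (r ∷ s) = suc (rights s)

rights-++ : ∀ s t → rights (s ++ t) ≡ rights s + rights t
rights-++ []      t = refl
rights-++ (u ∷ s) t = rights-++ s t
rights-++ (r ∷ s) t = cong suc (rights-++ s t)

upAbscissae-++ : ∀ x s t →
  upAbscissae x (s ++ t) ≡ upAbscissae x s ++ upAbscissae (x + rights s) t
upAbscissae-++ x []      t rewrite +-identityʳ x        = refl
upAbscissae-++ x (u ∷ s) t = cong (x ∷_) (upAbscissae-++ x s t)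
upAbscissae-++ x (r ∷ s) t rewrite +-suc x (rights s) = upAbscissae-++ (suc x) s t

module _ {d : ℕ} {w L R : List ℕ} {m : ℕ} (sp : IsSplit w L m R) (|w|≤ : length w ≤ suc d) where
  open IsSplit sp

  |L*|≤ : length (standardize L) ≤ d
  |L*|≤ = ≤-trans (≤-reflexive (length-map (rank L) L)) (s≤s⁻¹ (begin
    suc (length L)            ≤⟨ s≤s (m≤m+n _ _) ⟩
    suc (length L + length R) ≡⟨ +-suc _ _ ⟨
    length L + suc (length R) ≡⟨ length≡ ⟩
    length w                  ≤⟨ |w|≤ ⟩
    suc d                     ∎))
    where open ≤-Reasoning

  |R*|≤ : length (standardize R) ≤ d
  |R*|≤ = ≤-trans (≤-reflexive (length-map (rank R) R))
    (s≤s⁻¹ (≤-trans (m≤n+m _ (length L)) (≤-trans (≤-reflexive length≡) |w|≤)))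

-- Tells at which abscissa the path of the right part starts: the left part and the step `r`
-- together advance by `suc (length L)`.
rights-dyckWithin : ∀ d {w} → Standard w → length w ≤ d → rights (dyckWithin d w) ≡ length w
rights-dyckWithin zero    {[]}        std |w|≤ = refl
rights-dyckWithin (suc d) {[]}        std |w|≤ = refl
rights-dyckWithin (suc d) {w@(_ ∷ _)} std |w|≤ = begin
  rights (DL ++ r ∷ DR)                                ≡⟨ rights-++ DL (r ∷ DR) ⟩
  rights DL + suc (rights DR)                          ≡⟨ cong₂ (λ i j → i + suc j)
      (rights-dyckWithin d (standardize-Standard L-unique) (|L*|≤ sp |w|≤))
      (rights-dyckWithin d (standardize-Standard R-unique) (|R*|≤ sp |w|≤)) ⟩
  length (standardize L) + suc (length (standardize R)) ≡⟨ cong₂ (λ i j → i + suc j)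
      (length-map (rank L) L) (length-map (rank R) R) ⟩
  length L + suc (length R)                            ≡⟨ length≡ ⟩
  length w                                             ∎
  where
  open ≡-Reasoning
  L = before (length w) w
  R = after (length w) w
  DL = dyckWithin d (standardize L)
  DR = dyckWithin d (standardize R)
  sp = split std (s≤s z≤n)
  open IsSplit sp

-- Agreement is only up to reordering because the path makes the up step of the maximal letter
-- before those of `L`, whereas the letter itself comes after `L`. The start `x` is arbitrary
-- because the path of `R` begins further right.
upAbscissae-dyckWithin : ∀ d x {w} → Standard w → length w ≤ d →
  upAbscissae x (dyckWithin d w) ↭ borders x (const x) w
upAbscissae-dyckWithin zero    x {[]}        std |w|≤ = ↭-refl
upAbscissae-dyckWithin (suc d) x {[]}        std |w|≤ = ↭-refl
upAbscissae-dyckWithin (suc d) x {w@(_ ∷ _)} std |w|≤ = begin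
  x ∷ upAbscissae x (DL ++ r ∷ DR)
    ≡⟨ cong (x ∷_) (upAbscissae-++ x DL (r ∷ DR)) ⟩
  x ∷ upAbscissae x DL ++ upAbscissae (suc (x + rights DL)) DR
    ≡⟨ cong (λ i → x ∷ upAbscissae x DL ++ upAbscissae (suc (x + i)) DR)
         (trans (rights-dyckWithin d L*-std (|L*|≤ sp |w|≤)) (length-map (rank L) L)) ⟩
  x ∷ upAbscissae x DL ++ upAbscissae x′ DR
    ↭⟨ prep x (++⁺ (upAbscissae-dyckWithin d x L*-std (|L*|≤ sp |w|≤))
                   (upAbscissae-dyckWithin d x′ R*-std (|R*|≤ sp |w|≤))) ⟩
  x ∷ borders x (const x) (standardize L) ++ borders x′ (const x′) (standardize R)
    ≡⟨ cong₂ (λ v v′ → x ∷ v ++ v′) (borders-standardize x L) (borders-standardize x′ R) ⟩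
  x ∷ borders x (const x) L ++ borders x′ (const x′) R
    ↭⟨ shift x (borders x (const x) L) _ ⟨
  borders x (const x) L ++ x ∷ borders x′ (const x′) R
    ≡⟨ borders-split x L L≤m R<m ⟨
  borders x (const x) (L ++ length w ∷ R)
    ≡⟨ cong (borders x (const x)) word≡ ⟩
  borders x (const x) w ∎
  where
  open PermutationReasoning
  L = before (length w) w
  R = after (length w) w
  x′ = suc (x + length L)
  DL = dyckWithin d (standardize L)
  DR = dyckWithin d (standardize R)
  sp = split std (s≤s z≤n)
  open IsSplit sp
  L*-std = standardize-Standard L-unique
  R*-std = standardize-Standard R-unique

-- Left borders of permutations

-- The last index at which p holds, counted from suc c, or x if there is none.
lastTrue : ℕ → ℕ → (Fin k → Bool) → ℕ
lastTrue {zero}  c x p = x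
lastTrue {suc k} c x p = lastTrue (suc c) (if p Fin.zero then suc c else x) (p ∘ Fin.suc)

lastTrue-false : ∀ k c x → lastTrue {k} c x (const false) ≡ x
lastTrue-false zero    c x = refl
lastTrue-false (suc k) c x = lastTrue-false k (suc c) x

-- At the first position the predicate is constantly false, so the start value remains. At a later
-- one the first step of `lastTrue` computes to `push`, and the induction continues with the pushed
-- border function.
borders-tabulate : ∀ c b (g : Fin k → ℕ) → borders c b (tabulate g) ≡
  tabulate (λ j → lastTrue c (b (g j)) (λ m → does (m Fin.<? j) ∧ does (g j <? g m)))
borders-tabulate {zero}  c b g = refl
borders-tabulate {suc k} c b g = cong₂ _∷_ (sym (lastTrue-false k (suc c) _))
  (borders-tabulate (suc c) (push c (g Fin.zero) b) (g ∘ Fin.suc))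

⊔-foldr : ∀ x y w → x ⊔ foldr _⊔_ y w ≡ foldr _⊔_ (x ⊔ y) w
⊔-foldr x y []      = refl
⊔-foldr x y (z ∷ w) = begin
  x ⊔ (z ⊔ foldr _⊔_ y w) ≡⟨ ⊔-assoc x z _ ⟨
  x ⊔ z ⊔ foldr _⊔_ y w   ≡⟨ cong (_⊔ foldr _⊔_ y w) (⊔-comm x z) ⟩
  z ⊔ x ⊔ foldr _⊔_ y w   ≡⟨ ⊔-assoc z x _ ⟩
  z ⊔ (x ⊔ foldr _⊔_ y w) ≡⟨ cong (z ⊔_) (⊔-foldr x y w) ⟩
  z ⊔ foldr _⊔_ (x ⊔ y) w ∎
  where open ≡-Reasoning

-- The values increase along the list, so their maximum is the last one. In the induction `x ≤ c`
-- makes a new value `suc c` supersede the accumulator `x`, as it does in `lastTrue`.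
max-filter≡lastTrue : {P : Fin n → Set} (P? : Decidable P) (f : Fin k → Fin n) → ∀ c {x} →
  (∀ i → toℕ (f i) ≡ c + toℕ i) → x ≤ c →
  foldr _⊔_ x (map val (filter P? (tabulate f))) ≡ lastTrue c x (does ∘ P? ∘ f)
max-filter≡lastTrue {k = zero}  P? f c f≡ x≤c = refl
max-filter≡lastTrue {k = suc k} P? f c {x} f≡ x≤c with does (P? (f Fin.zero))
... | false = max-filter≡lastTrue P? (f ∘ Fin.suc) (suc c) (λ i → trans (f≡ _) (+-suc c _))
                (m≤n⇒m≤1+n x≤c)
... | true  = begin
  suc (toℕ (f Fin.zero)) ⊔ foldr _⊔_ x rest ≡⟨ cong (λ y → suc y ⊔ foldr _⊔_ x rest)
                                                 (trans (f≡ Fin.zero) (+-identityʳ c)) ⟩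
  suc c ⊔ foldr _⊔_ x rest                  ≡⟨ ⊔-foldr (suc c) x rest ⟩
  foldr _⊔_ (suc c ⊔ x) rest                ≡⟨ cong (λ y → foldr _⊔_ y rest)
                                                 (m≥n⇒m⊔n≡m (m≤n⇒m≤1+n x≤c)) ⟩
  foldr _⊔_ (suc c) rest                    ≡⟨ max-filter≡lastTrue P? (f ∘ Fin.suc) (suc c)
                                                 (λ i → trans (f≡ _) (+-suc c _)) ≤-refl ⟩
  lastTrue (suc c) (suc c) (does ∘ P? ∘ f ∘ Fin.suc) ∎
  where
  open ≡-Reasoning
  rest = map val (filter P? (tabulate (f ∘ Fin.suc)))

borders-word : (π : Permutation′ n) → borders 0 (const 0) (word π) ≡ tabulate (leftBorder π)
borders-word π = trans (borders-tabulate 0 (const 0) (λ i → val (π ⟨$⟩ʳ i)))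
  -- `does` of `inversion?` unfolds to the conjunction in `borders-tabulate`; the successors added
  -- by `val` cancel in `<?`.
  (tabulate-cong λ j → sym (max-filter≡lastTrue (λ m → inversion? π m j) id 0 (λ _ → refl) z≤n))

⟨$⟩ʳ-injective : (π : Permutation′ n) → ∀ {i j} → π ⟨$⟩ʳ i ≡ π ⟨$⟩ʳ j → i ≡ j
⟨$⟩ʳ-injective π eq = trans (sym (inverseˡ π)) (trans (cong (π ⟨$⟩ˡ_) eq) (inverseˡ π))

word-Standard : (π : Permutation′ n) → Standard (word π)
word-Standard {n} π = record
  { unique  = Uniqueₚ.tabulate⁺ (⟨$⟩ʳ-injective π ∘ Finₚ.toℕ-injective ∘ suc-injective)
  ; bounded = subst (λ l → All (_≤ l) (word π)) (sym |word|)
                (Allₚ.tabulate⁺ λ i → Finₚ.toℕ<n (π ⟨$⟩ʳ i))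
  ; top     = λ 0<l → subst (_∈ word π) (sym |word|) (n∈word π (subst (0 <_) |word| 0<l))
  }
  where
  |word| = length-tabulate (λ i → val (π ⟨$⟩ʳ i))
  n∈word : ∀ {n} (π : Permutation′ n) → 0 < n → n ∈ word π
  n∈word {suc n} π _ = subst (_∈ word π)
    (cong suc (trans (cong toℕ (inverseʳ π)) (Finₚ.toℕ-fromℕ n)))
    (∈-tabulate⁺ {f = λ i → val (π ⟨$⟩ʳ i)} (π ⟨$⟩ˡ Fin.fromℕ n))

upAbscissae-word : (π : Permutation′ n) → upAbscissae 0 (dyckWord (word π)) ↭ tabulate (leftBorder π)
upAbscissae-word π = ↭-trans (upAbscissae-dyckWithin _ 0 (word-Standard π) ≤-refl)
  (↭-reflexive (borders-word π))

count-Λ : (π : Permutation′ n) → ∀ i →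
  length (filter (_≟ suc i) (Λ π)) ≡ length (positionsWithBorder π (suc i))
count-Λ {n} π i = begin
  length (filter (_≟ suc i) (Λ π))
    ≡⟨ ↭-length (filter-↭ (_≟ suc i) (↭-reverse (drop 1 (upAbscissae 0 (dyckWord (word π)))))) ⟩
  length (filter (_≟ suc i) (drop 1 (upAbscissae 0 (dyckWord (word π)))))
    ≡⟨ drop-first π ⟩
  length (filter (_≟ suc i) (upAbscissae 0 (dyckWord (word π))))
    ≡⟨ ↭-length (filter-↭ (_≟ suc i) (upAbscissae-word π)) ⟩
  length (filter (_≟ suc i) (tabulate (leftBorder π)))
    ≡⟨ cong (length ∘ filter (_≟ suc i)) (map-tabulate id (leftBorder π)) ⟨
  length (filter (_≟ suc i) (map (leftBorder π) (allFin n)))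
    ≡⟨ length-filter-map (_≟ suc i) (leftBorder π) (allFin n) ⟩
  length (positionsWithBorder π (suc i)) ∎
  where
  open ≡-Reasoning
  -- The dropped first part is 0, while only positive parts are counted. Matching on `n` lets the
  -- path compute as far as its first step.
  drop-first : ∀ {n} (π : Permutation′ n) →
    length (filter (_≟ suc i) (drop 1 (upAbscissae 0 (dyckWord (word π))))) ≡
    length (filter (_≟ suc i) (upAbscissae 0 (dyckWord (word π))))
  drop-first {zero}  π = refl
  drop-first {suc n} π = refl

-- Recovering the left borders from the shape

≤-foldr-⊔ : ∀ {x w} → x ∈ w → x ≤ foldr _⊔_ 0 w
≤-foldr-⊔ (here refl) = m≤m⊔n _ _
≤-foldr-⊔ (there x∈) = ≤-trans (≤-foldr-⊔ x∈) (m≤n⊔m _ _)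

val≤leftBorder : (π : Permutation′ n) → ∀ {m j} → Inversion π m j → val m ≤ leftBorder π j
val≤leftBorder π {m} {j} inv =
  ≤-foldr-⊔ (∈-map⁺ val (∈-filter⁺ (λ m → inversion? π m j) (∈-allFin m) inv))

leftBorder-attained : (π : Permutation′ n) → ∀ {j} → 0 < leftBorder π j →
                      ∃[ m ] Inversion π m j × leftBorder π j ≡ val m
leftBorder-attained {n} π {j} 0<b
  with foldr-selective ⊔-sel 0 (map val (filter (λ m → inversion? π m j) (allFin n)))
... | inj₁ b≡0 = contradiction (sym b≡0) (<⇒≢ 0<b)
... | inj₂ b∈ with ∈-map⁻ val b∈
...   | m , m∈ , b≡ = m , proj₂ (∈-filter⁻ (λ m → inversion? π m j) {xs = allFin n} m∈) , b≡

-- If the border of j lies left of m < j, then j hides m from all later positions.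
hidden : (σ : Permutation′ n) → ∀ {m j} → m Fin.< j → leftBorder σ j < val m →
         ∀ {k} → leftBorder σ k ≡ val m → k Fin.< j
hidden σ {m} {j} m<j b<m {k} b≡ with Finₚ.<-cmp k j
... | tri< k<j _ _    = k<j
... | tri≈ _ refl _   = contradiction b≡ (<⇒≢ b<m)
-- Here `m` being the border of `k` gives `σk<σm`, and a letter at `j` above that at `k` would raise
-- the border of `k` beyond `m`. So `m` and `j` would form an inversion, forcing the border of `j`
-- up to `val m`.
... | tri> _ _ j<k    = contradiction (val≤leftBorder σ (m<j , σj<σm)) (<⇒≱ b<m)
  where
  σk<σm : (σ ⟨$⟩ʳ k) Fin.< (σ ⟨$⟩ʳ m)
  σk<σm with leftBorder-attained σ {k} (subst (0 <_) (sym b≡) (s≤s z≤n))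
  ... | m′ , (_ , σk<σm′) , b≡′
    rewrite Finₚ.toℕ-injective {i = m} {j = m′} (suc-injective (trans (sym b≡) b≡′)) = σk<σm′
  σj≤σk : (σ ⟨$⟩ʳ j) Fin.≤ (σ ⟨$⟩ʳ k)
  σj≤σk = ≮⇒≥ λ σk<σj →
    <⇒≱ (s≤s m<j) (subst (val j ≤_) b≡ (val≤leftBorder σ (j<k , σk<σj)))
  σj<σm : (σ ⟨$⟩ʳ j) Fin.< (σ ⟨$⟩ʳ m)
  σj<σm = ≤-<-trans σj≤σk σk<σm

SameBorderCounts : Permutation′ n → Permutation′ n → Set
SameBorderCounts π σ = ∀ i →
  length (positionsWithBorder π (suc i)) ≡ length (positionsWithBorder σ (suc i))

leftBorder-≮ : (π σ : Permutation′ n) → SameBorderCounts π σ → ∀ {j} →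
  (∀ {k} → k Fin.< j → leftBorder π k ≡ leftBorder σ k) →
  ¬ (leftBorder σ j < leftBorder π j)
leftBorder-≮ π σ same {j} agree bσ<bπ with leftBorder-attained π {j} (≤-<-trans z≤n bσ<bπ)
... | m , (m<j , _) , bπ≡m = <⇒≢ fewer (sym (same (toℕ m)))
  where
  bσ<m : leftBorder σ j < val m
  bσ<m = subst (leftBorder σ j <_) bπ≡m bσ<bπ
  fewer : length (positionsWithBorder σ (val m)) < length (positionsWithBorder π (val m))
  -- By `hidden`, positions with border `val m` in `σ` precede `j`, where both permutations agree;
  -- `j` itself has this border in `π` only.
  fewer = length-filter-strictMono (λ k → leftBorder σ k ≟ val m) (λ k → leftBorder π k ≟ val m)
    (λ bσ≡m → trans (agree (hidden σ m<j bσ<m bσ≡m)) bσ≡m)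
    (∈-allFin j) bπ≡m (<⇒≢ bσ<m)

-- Well-founded induction on the position: agreement before `j` excludes a strict inequality at `j`
-- in either direction.
leftBorder-determined : (π σ : Permutation′ n) → SameBorderCounts π σ →
                        ∀ j → leftBorder π j ≡ leftBorder σ j
leftBorder-determined π σ same = wfRec _ λ j rec → ≤-antisym
  (≮⇒≥ (leftBorder-≮ π σ same rec))
  (≮⇒≥ (leftBorder-≮ σ π (sym ∘ same) (sym ∘ rec)))
  where open WF.All Finᵢ.<-wellFounded 0ℓ using (wfRec)

-- Recovering the inversions from the dots

zip-∈ˡ : ∀ (xs : List A) (ys : List B) {x y} → (x , y) ∈ zip xs ys → x ∈ xs
zip-∈ˡ (x ∷ xs) (y ∷ ys) (here refl) = here refl
zip-∈ˡ (x ∷ xs) (y ∷ ys) (there xy∈) = there (zip-∈ˡ xs ys xy∈)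

-- Equal lengths keep `zip` from cutting off `y`.
∈-zip : ∀ (xs : List A) {ys : List B} {y} → length xs ≡ length ys → y ∈ ys →
        ∃[ x ] (x , y) ∈ zip xs ys
∈-zip (x ∷ xs) eq (here refl) = x , here refl
∈-zip (x ∷ xs) eq (there y∈) with ∈-zip xs (suc-injective eq) y∈
... | x′ , xy∈ = x′ , there xy∈

zip-functional : ∀ {xs : List A} {ys : List B} {x y y′} → Unique xs →
                 (x , y) ∈ zip xs ys → (x , y′) ∈ zip xs ys → y ≡ y′
zip-functional {xs = x ∷ xs} {y ∷ ys} _ (here refl) (here refl) = refl
zip-functional {xs = x ∷ xs} {y ∷ ys} (x∉ ∷ _) (here refl) (there q) =
  contradiction refl (All.lookup x∉ (zip-∈ˡ xs ys q))
zip-functional {xs = x ∷ xs} {y ∷ ys} (x∉ ∷ _) (there p) (here refl) =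
  contradiction refl (All.lookup x∉ (zip-∈ˡ xs ys p))
zip-functional {xs = x ∷ xs} {y ∷ ys} (_ ∷ xs!) (there p) (there q) = zip-functional xs! p q

length-rows : ∀ μ i → length (rowsOfLengthFromBottom μ i) ≡ length (filter (_≟ i) μ)
length-rows μ i = begin
  length (rowsOfLengthFromBottom μ i)
    ≡⟨ length-reverse (filter (λ s → lookup μ s ≟ i) rows) ⟩
  length (filter (λ s → lookup μ s ≟ i) rows)
    ≡⟨ length-filter-map (_≟ i) (lookup μ) rows ⟨
  length (filter (_≟ i) (map (lookup μ) rows))
    ≡⟨ cong (length ∘ filter (_≟ i)) (trans (map-tabulate id (lookup μ)) (tabulate-lookup μ)) ⟩
  length (filter (_≟ i) μ) ∎
  where
  open ≡-Reasoning
  rows = allFin (length μ)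

lookup-row : ∀ μ i {s} → s ∈ rowsOfLengthFromBottom μ i → lookup μ s ≡ i
lookup-row μ i s∈ =
  proj₂ (∈-filter⁻ (λ s → lookup μ s ≟ i) {xs = allFin (length μ)} (∈-resp-↭ (↭-reverse _) s∈))

rows-unique : ∀ μ i → Unique (rowsOfLengthFromBottom μ i)
rows-unique μ i = Unique-resp-↭ (setoid _) (↭⇒↭ₛ (↭-sym (↭-reverse _)))
  (Uniqueₚ.filter⁺ (λ s → lookup μ s ≟ i) (Uniqueₚ.allFin⁺ (length μ)))

-- RowLabel and Dotted with the shape and the groups of row labels as parameters,
-- so that those of two permutations can be compared.

LabelIn : (μ : List ℕ) → (ℕ → List (Fin n)) → Fin (length μ) → Fin n → Set
LabelIn μ ps s j = ∃[ i ] 1 ≤ i × (s , j) ∈ zip (rowsOfLengthFromBottom μ i) (ps i)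

DottedIn : List ℕ → (ℕ → List (Fin n)) → Permutation′ n → Cell → Set
DottedIn {n} μ ps π c =
  Σ[ s ∈ Fin (length μ) ] Σ[ i ∈ Fin n ] Σ[ j ∈ Fin n ]
    c ≡ (val s , val i) × val i ≤ lookup μ s × LabelIn μ ps s j × Inversion π i j

-- A row lies in one group only, that of its own length, and occurs there once.
LabelIn-functional : ∀ {μ} {ps : ℕ → List (Fin n)} {s j j′} →
                     LabelIn μ ps s j → LabelIn μ ps s j′ → j ≡ j′
LabelIn-functional {μ = μ} {ps} (i , _ , p) (i′ , _ , p′)
  with refl ← trans (sym (lookup-row μ i (zip-∈ˡ _ (ps i) p))) (lookup-row μ i′ (zip-∈ˡ _ (ps i′) p′))
  = zip-functional (rows-unique μ i) p p′

-- The row is sought in the group of the left border of `j`: by `count-Λ` this group has as many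
-- rows as labels, so `zip` reaches `j`. The row is as long as that border, which is at least
-- `val i`, so the cell lies in the diagram.
dot-of-inversion : (π : Permutation′ n) → ∀ {i j} → Inversion π i j →
  ∃[ s ] RowLabel π s j × Dotted π (val s , val i)
dot-of-inversion π {i} {j} inv with leftBorder-attained π {j} (≤-trans (s≤s z≤n) (val≤leftBorder π inv))
... | m , _ , b≡m with ∈-zip (rowsOfLengthFromBottom (Λ π) (val m))
                         (trans (length-rows (Λ π) (val m)) (count-Λ π (toℕ m)))
                         (∈-filter⁺ (λ j → leftBorder π j ≟ val m) (∈-allFin j) b≡m)
...   | s , sj∈ = s , label , s , i , j , refl , i≤row , label , inv
  where
  label : RowLabel π s j
  label = val m , s≤s z≤n , sj∈
  i≤row : val i ≤ lookup (Λ π) s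
  i≤row = subst (val i ≤_)
    (trans b≡m (sym (lookup-row (Λ π) (val m) (zip-∈ˡ _ (positionsWithBorder π (val m)) sj∈))))
    (val≤leftBorder π inv)

-- The cell fixes row and column, and the row fixes its label, so the dot can only come from the
-- pair `i`, `j`. The groups `ps` are free so that labels taken from one permutation can be read
-- against the inversions of another.
inversion-of-dot : ∀ {μ} {ps : ℕ → List (Fin n)} (σ : Permutation′ n) {s i j} →
  LabelIn μ ps s j → DottedIn μ ps σ (val s , val i) → Inversion σ i j
inversion-of-dot {μ = μ} {ps} σ {s} {i} label (s′ , i′ , j′ , c≡ , _ , label′ , inv)
  with refl ← Finₚ.toℕ-injective {i = s} {j = s′} (suc-injective (cong proj₁ c≡))
     | refl ← Finₚ.toℕ-injective {i = i} {j = i′} (suc-injective (cong proj₂ c≡))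
  with refl ← LabelIn-functional {μ = μ} {ps} label label′ = inv

inversion-transfer : (π σ : Permutation′ n) → Λ π ≡ Λ σ → (∀ {c} → Dotted π c → Dotted σ c) →
                     ∀ {i j} → Inversion π i j → Inversion σ i j
inversion-transfer {n} π σ Λ≡ dots⊆ {i} inv with dot-of-inversion π inv
... | s , label , dot = inversion-of-dot {μ = Λ π} {positionsWithBorder π} σ label (relabel (Λ π)
        (subst (λ μ → DottedIn μ (positionsWithBorder σ) σ (val s , val i)) (sym Λ≡) (dots⊆ dot)))
  where
  same : SameBorderCounts π σ
  same i = trans (sym (count-Λ π i))
    (trans (cong (length ∘ filter (_≟ suc i)) Λ≡) (count-Λ σ i))
  positions≡ : ∀ i → positionsWithBorder σ i ≡ positionsWithBorder π i
  positions≡ i = filter-≐ (λ j → leftBorder σ j ≟ i) (λ j → leftBorder π j ≟ i)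
    ( (λ {j} → trans (leftBorder-determined π σ same j))
    , (λ {j} → trans (sym (leftBorder-determined π σ same j))) ) (allFin n)
  relabel : ∀ μ {c} → DottedIn μ (positionsWithBorder σ) σ c → DottedIn μ (positionsWithBorder π) σ c
  relabel μ (s , i , j , c≡ , i≤ , (b , 1≤b , sj∈) , inv) = s , i , j , c≡ , i≤ ,
    (b , 1≤b , subst (λ ps → (s , j) ∈ zip (rowsOfLengthFromBottom μ b) ps) (positions≡ b) sj∈) , inv

-- Recovering the permutation from its inversions

-- If `j` precedes `i`, the comparison is itself an inversion of `π`. If `i` precedes `j`, the
-- reverse comparison in `σ` would be an inversion that `π` lacks.
<-transfer : (π σ : Permutation′ n) →
  (∀ {i j} → Inversion π i j → Inversion σ i j) → (∀ {i j} → Inversion σ i j → Inversion π i j) →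
  ∀ {i j} → (π ⟨$⟩ʳ i) Fin.< (π ⟨$⟩ʳ j) → (σ ⟨$⟩ʳ i) Fin.< (σ ⟨$⟩ʳ j)
<-transfer π σ π⊆σ σ⊆π {i} {j} πi<πj with Finₚ.<-cmp i j
... | tri≈ _ refl _ = contradiction πi<πj (<-irrefl refl)
... | tri> _ _ j<i  = proj₂ (π⊆σ (j<i , πi<πj))
... | tri< i<j i≢j _ = ≤∧≢⇒< (≮⇒≥ λ σj<σi → <-asym πi<πj (proj₂ (σ⊆π (i<j , σj<σi))))
                             (i≢j ∘ ⟨$⟩ʳ-injective σ ∘ Finₚ.toℕ-injective)

strictMono⇒inflationary : (f : Fin n → Fin n) → (∀ {i j} → i Fin.< j → f i Fin.< f j) →
                          ∀ i → i Fin.≤ f i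
strictMono⇒inflationary {suc n} f mono = Finᵢ.<-weakInduction (λ i → i Fin.≤ f i) z≤n λ i i≤fi →
  ≤-trans (s≤s (subst (_≤ toℕ (f (Fin.inject₁ i))) (Finₚ.toℕ-inject₁ i) i≤fi))
          (mono (s≤s (≤-reflexive (Finₚ.toℕ-inject₁ i))))

-- `σ` after the inverse of `π` is strictly increasing, so it lowers no value; at the value
-- `π ⟨$⟩ʳ i` it returns `σ ⟨$⟩ʳ i`.
≤-of-inversions : (π σ : Permutation′ n) →
  (∀ {i j} → Inversion π i j → Inversion σ i j) → (∀ {i j} → Inversion σ i j → Inversion π i j) →
  ∀ i → (π ⟨$⟩ʳ i) Fin.≤ (σ ⟨$⟩ʳ i)
≤-of-inversions π σ π⊆σ σ⊆π i = subst (λ k → (π ⟨$⟩ʳ i) Fin.≤ (σ ⟨$⟩ʳ k)) (inverseˡ π)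
  (strictMono⇒inflationary (λ v → σ ⟨$⟩ʳ (π ⟨$⟩ˡ v))
    (λ v<v′ → <-transfer π σ π⊆σ σ⊆π (subst₂ Fin._<_ (sym (inverseʳ π)) (sym (inverseʳ π)) v<v′))
    (π ⟨$⟩ʳ i))

mainTheorem8 : (n : ℕ) → n ≥ 1 → Injective (_≈_ {n} {n}) _≋_ (filledShape {n})
mainTheorem8 n _ {π} {σ} (Λ≡ , dots⊆ , dots⊇) i = Finₚ.toℕ-injective
  (≤-antisym (≤-of-inversions π σ π⊆σ σ⊆π i) (≤-of-inversions σ π σ⊆π π⊆σ i))
  where
  π⊆σ : ∀ {i j} → Inversion π i j → Inversion σ i j
  π⊆σ = inversion-transfer π σ Λ≡ dots⊆
  σ⊆π : ∀ {i j} → Inversion σ i j → Inversion π i j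
  σ⊆π = inversion-transfer σ π (sym Λ≡) dots⊇
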